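{- The logic $\mathrm{Tack}_2$ is prelocally tabular, i.e., every proper normal extension of $\mathrm{Tack}_2$ (in the bimodal language with $\lozenge_1,\lozenge_2$) is locally tabular.
   Context: For sets $X,Y$, let $\mathrm{T}(X,Y)$ be the bimodal frame with domain $(X\times Y)\cup\{t\}$ ($t$ a new point) and relations $R_1=\{((a,b),(a',b)):a,a'\in X,b\in Y\}\cup((X\times Y)\times\{t\})\cup\{(t,t)\}$ and $R_2=\{((a,b),(a,b')):a\in X,b,b'\in Y\}\cup\{(t,t)\}$ (the "two-dimensional tack"; $R_1$ interprets $\lozenge_1$, $R_2$ interprets $\lozenge_2$). $\mathrm{Tack}_2$ is the set of bimodal formulas valid in $\mathrm{T}(\omega,\omega)$. A logic is locally tabular if for each finite $k$ it has only finitely many pairwise nonequivalent formulas in $k$ variables. -}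

module Defs where

open import Data.Nat using (ℕ; _<_)
open import Data.Bool using (Bool; true)
open import Data.Product using (_×_; Σ; ∃; _,_)
open import Data.Unit using (⊤)
open import Data.Empty using (⊥)
open import Data.List using (List)
open import Data.List.Membership.Propositional using (_∈_)
open import Relation.Binary.PropositionalEquality using (_≡_)
open import Relation.Nullary using (¬_)

infixr 5 _⇒_
data Fm : Set where
  var : ℕ → Fm
  ⊥'  : Fm
  _⇒_ : Fm → Fm → Fm
  □₁  : Fm → Fm
  □₂  : Fm → Fm

¬' : Fm → Fm
¬' φ = φ ⇒ ⊥'

◇₁ : Fm → Fm
◇₁ φ = ¬' (□₁ (¬' φ))

◇₂ : Fm → Fm
◇₂ φ = ¬' (□₂ (¬' φ))

sub : (ℕ → Fm) → Fm → Fm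
sub σ (var n) = σ n
sub σ ⊥' = ⊥'
sub σ (φ ⇒ ψ) = sub σ φ ⇒ sub σ ψ
sub σ (□₁ φ) = □₁ (sub σ φ)
sub σ (□₂ φ) = □₂ (sub σ φ)

VarsBelow : ℕ → Fm → Set
VarsBelow k (var n) = n < k
VarsBelow k ⊥' = ⊤
VarsBelow k (φ ⇒ ψ) = VarsBelow k φ × VarsBelow k ψ
VarsBelow k (□₁ φ) = VarsBelow k φ
VarsBelow k (□₂ φ) = VarsBelow k φ

-- Kripke semantics on bimodal frames (classical: valuations are
-- Bool-valued, and with □ as the only modal primitive every truth
-- value is ¬¬-stable, so the semantics is the classical one)

record Frame : Set₁ where
  field
    W  : Set
    R₁ : W → W → Set
    R₂ : W → W → Set

module _ (F : Frame) where
  open Frame F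

  _⊨_at_ : (ℕ → W → Bool) → Fm → W → Set
  V ⊨ var n at w = V n w ≡ true
  V ⊨ ⊥' at w = ⊥
  V ⊨ (φ ⇒ ψ) at w = V ⊨ φ at w → V ⊨ ψ at w
  V ⊨ □₁ φ at w = ∀ v → R₁ w v → V ⊨ φ at v
  V ⊨ □₂ φ at w = ∀ v → R₂ w v → V ⊨ φ at v

  ValidIn : Fm → Set
  ValidIn φ = ∀ (V : ℕ → W → Bool) (w : W) → V ⊨ φ at w

data TW (X Y : Set) : Set where
  pt : X → Y → TW X Y
  t  : TW X Y

TR₁ : {X Y : Set} → TW X Y → TW X Y → Set
TR₁ (pt a b) (pt a′ b′) = b ≡ b′
TR₁ (pt a b) t = ⊤
TR₁ t (pt a′ b′) = ⊥
TR₁ t t = ⊤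

TR₂ : {X Y : Set} → TW X Y → TW X Y → Set
TR₂ (pt a b) (pt a′ b′) = a ≡ a′
TR₂ (pt a b) t = ⊥
TR₂ t (pt a′ b′) = ⊥
TR₂ t t = ⊤

Tack : Set → Set → Frame
Tack X Y = record { W = TW X Y ; R₁ = TR₁ ; R₂ = TR₂ }

Tack₂ : Fm → Set
Tack₂ = ValidIn (Tack ℕ ℕ)

record IsNormalLogic (L : Fm → Set) : Set where
  field
    ax1  : ∀ φ ψ → L (φ ⇒ (ψ ⇒ φ))
    ax2  : ∀ φ ψ χ → L ((φ ⇒ (ψ ⇒ χ)) ⇒ ((φ ⇒ ψ) ⇒ (φ ⇒ χ)))
    ax3  : ∀ φ → L (¬' (¬' φ) ⇒ φ)
    K₁   : ∀ φ ψ → L (□₁ (φ ⇒ ψ) ⇒ (□₁ φ ⇒ □₁ ψ))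
    K₂   : ∀ φ ψ → L (□₂ (φ ⇒ ψ) ⇒ (□₂ φ ⇒ □₂ ψ))
    mp   : ∀ φ ψ → L φ → L (φ ⇒ ψ) → L ψ
    nec₁ : ∀ φ → L φ → L (□₁ φ)
    nec₂ : ∀ φ → L φ → L (□₂ φ)
    subst : ∀ σ φ → L φ → L (sub σ φ)

ProperNormalExtension : (L₀ L : Fm → Set) → Set
ProperNormalExtension L₀ L =
  IsNormalLogic L × (∀ φ → L₀ φ → L φ) × (∃ λ φ → L φ × ¬ L₀ φ)

_≡[_]_ : Fm → (Fm → Set) → Fm → Set
φ ≡[ L ] ψ = L (φ ⇒ ψ) × L (ψ ⇒ φ)

LocallyTabular : (Fm → Set) → Set
LocallyTabular L =
  ∀ (k : ℕ) → Σ (List Fm) λ reps →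
    ∀ φ → VarsBelow k φ → ∃ λ ψ → ψ ∈ reps × VarsBelow k ψ × (φ ≡[ L ] ψ)

PrelocallyTabular : (Fm → Set) → Set₁
PrelocallyTabular L₀ = ∀ (L : Fm → Set) → ProperNormalExtension L₀ L → LocallyTabular L

{-# OPTIONS --safe #-}

-- Let φ₀ ∈ L fail in a model V₀ on T(ω,ω), and fix k. It suffices to find finitely many
-- substitution instances of φ₀ such that every pointed model on T(ω,ω) satisfying their
-- boxed versions agrees on k-variable formulas with one of finitely many finite pointed models.
--
-- Unless all points look like t, the point t is definable, and rows and columns can be
-- classified by alternating refinement: rows by the colours and column classes they meet,
-- then columns by the colours and row classes they meet, and so on. If one of the two
-- partitions fails to refine at some level i < N, the current pair of partitions is stable
-- and the quotient is a bisimilar finite model of bounded size. Otherwise there are more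
-- than N definable classes of rows and of columns, which map the model onto an
-- (N+1) × (N+1) grid. For N depending only on φ₀, such a grid carries a model with the same
-- subformula types as V₀: every block of a row class and a column class of V₀ is blown up to
-- a Latin square of its types. Hence a substitution instance of φ₀ fails.
--
-- Truth values are ¬¬-stable, so classical reasoning is available inside ¬¬.
module Submission where

open import Defs
open import Data.Bool using (Bool; true; false; _xor_; if_then_else_)
open import Data.Bool.Properties using () renaming (_≟_ to _≟ᵇ_)
open import Data.Empty using (⊥; ⊥-elim)
open import Data.Fin using (Fin; zero; suc; toℕ; fromℕ<)
open import Data.Fin.Properties using (toℕ<n; toℕ-fromℕ<)
open import Data.List using (List; []; _∷_; _++_; map; concatMap; cartesianProduct; cartesianProductWith; filter; length; lookup; upTo; allFin)
open import Data.List.Membership.Propositional using (_∈_; find; lose)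
open import Data.List.Membership.Propositional.Properties using (∈-map⁺; ∈-map⁻; ∈-++⁺ˡ; ∈-++⁺ʳ; ∈-++⁻; ∈-cartesianProduct⁺; ∈-cartesianProductWith⁺; ∈-concatMap⁺; ∈-upTo⁺; ∈-allFin; ∈-filter⁺; ∈-filter⁻)
open import Data.List.Properties using (filter-notAll)
open import Data.List.Relation.Unary.All using (all?) renaming (lookup to All-lookup)
open import Data.List.Relation.Unary.All.Properties using (¬All⇒Any¬)
open import Data.List.Relation.Unary.Any using (here; there; index; any?)
open import Data.List.Relation.Unary.Any.Properties using (lookup-index)
open import Data.Maybe using (Maybe; just; nothing)
open import Data.Nat using (ℕ; zero; suc; _≤_; _<_; z≤n; s≤s; _⊔_)
open import Data.Nat.Properties using (≤-refl; ≤-trans; <-≤-trans; n≤1+n; m≤m⊔n; m≤n⊔m)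
open import Data.Product using (_×_; Σ; ∃; ∃₂; _,_; proj₁; proj₂; swap)
open import Data.Sum using (_⊎_; inj₁; inj₂)
open import Data.Unit using (⊤; tt)
open import Data.Vec using (Vec; []; _∷_; zipWith; replicate; fromList) renaming (map to mapᵛ)
open import Data.Vec.Properties using (≡-dec; ∷-injective)
open import Function using (_∘_; id)
open import Relation.Binary.PropositionalEquality using (_≡_; refl; sym; trans; cong; cong₂; subst)
open import Relation.Nullary using (¬_; Dec; yes; no)
open import Relation.Nullary.Decidable using (¬?)

-- Double negation

¬¬ : Set → Set
¬¬ A = ¬ (¬ A)

return : {A : Set} → A → ¬¬ A
return a k = k a

infixl 1 _>>=_
_>>=_ : {A B : Set} → ¬¬ A → (A → ¬¬ B) → ¬¬ B
(m >>= f) k = m (λ a → f a k)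

em : {A : Set} → ¬¬ (A ⊎ ¬ A)
em k = k (inj₂ (k ∘ inj₁))

-- Double negation passes through a universal quantifier over a finite domain by induction. This is
-- the choice principle used to build grids, and a reason for indexing them by `Fin`.
¬¬-choice : ∀ n {P : Fin n → Set} → (∀ i → ¬¬ (P i)) → ¬¬ (∀ i → P i)
¬¬-choice zero f = return λ ()
¬¬-choice (suc n) f = do
  p ← f zero
  ps ← ¬¬-choice n (f ∘ suc)
  return λ { zero → p ; (suc i) → ps i }

Iff : Set → Set → Set
Iff A B = (A → B) × (B → A)

Iff-trans : {A B C : Set} → Iff A B → Iff B C → Iff A C
Iff-trans (f , g) (f′ , g′) = f′ ∘ f , g ∘ g′

≡true-ext : ∀ {b c : Bool} → Iff (b ≡ true) (c ≡ true) → b ≡ c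
≡true-ext {true} {c} (f , _) = sym (f refl)
≡true-ext {false} {true} (_ , g) = g refl
≡true-ext {false} {false} _ = refl

≡true-stable : ∀ {b : Bool} → ¬¬ (b ≡ true) → b ≡ true
≡true-stable {true} _ = refl
≡true-stable {false} h = ⊥-elim (h λ ())

-- Finite enumerations

allVecs : ∀ n → List (Vec Bool n)
allVecs zero = [] ∷ []
allVecs (suc n) = map (true ∷_) (allVecs n) ++ map (false ∷_) (allVecs n)

∈-allVecs : ∀ {n} (v : Vec Bool n) → v ∈ allVecs n
∈-allVecs [] = here refl
∈-allVecs (true ∷ v) = ∈-++⁺ˡ (∈-map⁺ (true ∷_) (∈-allVecs v))
∈-allVecs (false ∷ v) = ∈-++⁺ʳ _ (∈-map⁺ (false ∷_) (∈-allVecs v))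

_⊕_ : ∀ {n} → Vec Bool n → Vec Bool n → Vec Bool n
_⊕_ = zipWith _xor_

⊕-cancelˡ : ∀ {n} (x z : Vec Bool n) → x ⊕ (x ⊕ z) ≡ z
⊕-cancelˡ [] [] = refl
⊕-cancelˡ (false ∷ x) (b ∷ z) = cong (b ∷_) (⊕-cancelˡ x z)
⊕-cancelˡ (true ∷ x) (true ∷ z) = cong (true ∷_) (⊕-cancelˡ x z)
⊕-cancelˡ (true ∷ x) (false ∷ z) = cong (false ∷_) (⊕-cancelˡ x z)

⊕-cancelʳ : ∀ {n} (z y : Vec Bool n) → (z ⊕ y) ⊕ y ≡ z
⊕-cancelʳ [] [] = refl
⊕-cancelʳ (false ∷ z) (false ∷ y) = cong (false ∷_) (⊕-cancelʳ z y)
⊕-cancelʳ (false ∷ z) (true ∷ y) = cong (false ∷_) (⊕-cancelʳ z y)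
⊕-cancelʳ (true ∷ z) (false ∷ y) = cong (true ∷_) (⊕-cancelʳ z y)
⊕-cancelʳ (true ∷ z) (true ∷ y) = cong (true ∷_) (⊕-cancelʳ z y)

sublists : {A : Set} → List A → List (List A)
sublists [] = [] ∷ []
sublists (x ∷ xs) = map (x ∷_) (sublists xs) ++ sublists xs

comprehension : {A : Set} (P : A → Set) (xs : List A) →
  ¬¬ (∃ λ ys → ys ∈ sublists xs × (∀ x → x ∈ ys → P x) × (∀ x → x ∈ xs → P x → x ∈ ys))
comprehension P [] = return ([] , here refl , (λ _ ()) , λ _ ())
comprehension P (x ∷ xs) = do
  ys , ys∈ , sound , complete ← comprehension P xs
  inj₁ px ← em {P x}
    where inj₂ ¬px → return (ys , ∈-++⁺ʳ _ ys∈ , sound ,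
                       λ { _ (here refl) px → ⊥-elim (¬px px) ; y (there y∈) py → complete y y∈ py })
  return ( x ∷ ys , ∈-++⁺ˡ (∈-map⁺ (x ∷_) ys∈)
         , (λ { _ (here refl) → px ; y (there y∈) → sound y y∈ })
         , (λ { _ (here refl) _ → here refl ; y (there y∈) py → there (complete y y∈ py) }))

prepend : Fm → (ℕ → Fm) → ℕ → Fm
prepend χ σ zero = χ
prepend χ σ (suc n) = σ n

substitutions : List Fm → ℕ → List (ℕ → Fm)
substitutions C zero = var ∷ []
substitutions C (suc m) = cartesianProductWith prepend C (substitutions C m)

substitutions-complete : ∀ C m (P : ℕ → Fm → Set) → (∀ p → ¬¬ (∃ λ χ → χ ∈ C × P p χ)) →
  ¬¬ (∃ λ σ → σ ∈ substitutions C m × (∀ p → p < m → P p (σ p)))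
substitutions-complete C zero P h = return (var , here refl , λ _ ())
substitutions-complete C (suc m) P h = do
  χ , χ∈ , pχ ← h zero
  σ , σ∈ , pσ ← substitutions-complete C m (P ∘ suc) (h ∘ suc)
  return ( prepend χ σ , ∈-cartesianProductWith⁺ prepend χ∈ σ∈
         , λ { zero _ → pχ ; (suc p) (s≤s p<m) → pσ p p<m })

-- Truth in models on T(ω,ω)

World : Set
World = TW ℕ ℕ

Val : Set
Val = ℕ → World → Bool

sat : Val → World → Fm → Set
sat V w φ = _⊨_at_ (Tack ℕ ℕ) V φ w

-- Atoms are Bool-valued, and implications and boxes inherit stability from their conclusions. This
-- is how arguments inside ¬¬ are brought back to plain truth.
sat-stable : ∀ V w φ → ¬¬ (sat V w φ) → sat V w φ
sat-stable V w (var n) h = ≡true-stable h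
sat-stable V w ⊥' h = h id
sat-stable V w (φ ⇒ ψ) h p = sat-stable V w ψ λ k → h λ f → k (f p)
sat-stable V w (□₁ φ) h v r = sat-stable V v φ λ k → h λ f → k (f v r)
sat-stable V w (□₂ φ) h v r = sat-stable V v φ λ k → h λ f → k (f v r)

_∧′_ : Fm → Fm → Fm
φ ∧′ ψ = ¬' (φ ⇒ ¬' ψ)

⋁ : List Fm → Fm
⋁ [] = ⊥'
⋁ (φ ∷ φs) = ¬' φ ⇒ ⋁ φs

∧-elim : ∀ V w φ ψ → sat V w (φ ∧′ ψ) → sat V w φ × sat V w ψ
∧-elim V w φ ψ h = sat-stable V w φ (λ k → h λ p _ → k p) , sat-stable V w ψ (λ k → h λ _ q → k q)

⋁-intro : ∀ V w {φ} φs → φ ∈ φs → sat V w φ → sat V w (⋁ φs)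
⋁-intro V w (_ ∷ φs) (here refl) p ¬p = sat-stable V w (⋁ φs) λ _ → ¬p p
⋁-intro V w (_ ∷ φs) (there φ∈) p _ = ⋁-intro V w φs φ∈ p

⋁-elim : ∀ V w φs → sat V w (⋁ φs) → ¬¬ (∃ λ φ → φ ∈ φs × sat V w φ)
⋁-elim V w [] ()
⋁-elim V w (φ ∷ φs) h = do
  inj₂ ¬p ← em {sat V w φ}
    where inj₁ p → return (φ , here refl , p)
  ψ , ψ∈ , q ← ⋁-elim V w φs (h ¬p)
  return (ψ , there ψ∈ , q)

-- Types over a finite list of formulas

Agree : Val → List Fm → World → World → Set
Agree V Δ w v = ∀ δ → δ ∈ Δ → Iff (sat V w δ) (sat V v δ)

Agree-refl : ∀ V Δ {w} → Agree V Δ w w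
Agree-refl V Δ _ _ = id , id

Agree-sym : ∀ V Δ {w v} → Agree V Δ w v → Agree V Δ v w
Agree-sym V Δ h δ δ∈ = swap (h δ δ∈)

Agree-trans : ∀ V Δ {w v u} → Agree V Δ w v → Agree V Δ v u → Agree V Δ w u
Agree-trans V Δ h h′ δ δ∈ = Iff-trans (h δ δ∈) (h′ δ δ∈)

-- A relation and not a function, since truth on the infinite frame cannot be computed; a type
-- exists only under ¬¬.
HasType : Val → (Δ : List Fm) → World → Vec Bool (length Δ) → Set
HasType V [] w [] = ⊤
HasType V (δ ∷ Δ) w (b ∷ c) = Iff (sat V w δ) (b ≡ true) × HasType V Δ w c

HasType-total : ∀ V Δ w → ¬¬ (∃ (HasType V Δ w))
HasType-total V [] w = return ([] , tt)
HasType-total V (δ ∷ Δ) w = do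
  c , h ← HasType-total V Δ w
  inj₁ p ← em {sat V w δ}
    where inj₂ ¬p → return (false ∷ c , ((λ p → ⊥-elim (¬p p)) , λ ()) , h)
  return (true ∷ c , ((λ _ → refl) , λ _ → p) , h)

HasType-agree : ∀ V Δ {w v c} → HasType V Δ w c → HasType V Δ v c → Agree V Δ w v
HasType-agree V (δ ∷ Δ) {c = b ∷ c} (e , _) (e′ , _) _ (here refl) = Iff-trans e (swap e′)
HasType-agree V (δ ∷ Δ) {c = b ∷ c} (_ , h) (_ , h′) ε (there ε∈) = HasType-agree V Δ h h′ ε ε∈

HasType-resp : ∀ V Δ {w v c} → Agree V Δ w v → HasType V Δ w c → HasType V Δ v c
HasType-resp V [] {c = []} a h = tt
HasType-resp V (δ ∷ Δ) {c = b ∷ c} a (e , h) =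
  Iff-trans (swap (a δ (here refl))) e , HasType-resp V Δ (λ ε → a ε ∘ there) h

literal : Bool → Fm → Fm
literal true δ = δ
literal false δ = ¬' δ

typeFm : (Δ : List Fm) → Vec Bool (length Δ) → Fm
typeFm [] [] = ¬' ⊥'
typeFm (δ ∷ Δ) (b ∷ c) = literal b δ ∧′ typeFm Δ c

types : List Fm → List Fm
types Δ = map (typeFm Δ) (allVecs (length Δ))

literal-intro : ∀ V w b δ → Iff (sat V w δ) (b ≡ true) → sat V w (literal b δ)
literal-intro V w true δ (_ , g) = g refl
literal-intro V w false δ (f , _) p with () ← f p

literal-elim : ∀ V w b δ → sat V w (literal b δ) → Iff (sat V w δ) (b ≡ true)
literal-elim V w true δ h = (λ _ → refl) , λ _ → h
literal-elim V w false δ h = (λ p → ⊥-elim (h p)) , λ ()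

typeFm-intro : ∀ V Δ {w c} → HasType V Δ w c → sat V w (typeFm Δ c)
typeFm-intro V [] {c = []} _ = id
typeFm-intro V (δ ∷ Δ) {w} {b ∷ c} (e , h) k = k (literal-intro V w b δ e) (typeFm-intro V Δ h)

typeFm-elim : ∀ V Δ {w c} → sat V w (typeFm Δ c) → HasType V Δ w c
typeFm-elim V [] {c = []} _ = tt
typeFm-elim V (δ ∷ Δ) {w} {b ∷ c} h with ∧-elim V w (literal b δ) (typeFm Δ c) h
... | p , q = literal-elim V w b δ p , typeFm-elim V Δ q

combinations : List Fm → List Fm
combinations Δ = map (⋁ ∘ map (typeFm Δ)) (sublists (allVecs (length Δ)))

-- An invariant property is the union of the types it meets, so the disjunction of these types
-- defines it. The list `combinations Δ` depends on neither `V` nor `P`.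
combinations-complete : ∀ V Δ (P : World → Set) → (∀ {w v} → Agree V Δ w v → P w → P v) →
  ¬¬ (∃ λ χ → χ ∈ combinations Δ × ∀ w → Iff (sat V w χ) (¬¬ (P w)))
combinations-complete V Δ P resp = do
  cs , cs∈ , sound , complete ← comprehension (λ c → ∃ λ v → HasType V Δ v c × P v) (allVecs (length Δ))
  return (⋁ (map (typeFm Δ) cs) , ∈-map⁺ _ cs∈ , λ w →
    (λ s → do
      θ , θ∈ , p ← ⋁-elim V w (map (typeFm Δ) cs) s
      let c , c∈ , θ≡ = ∈-map⁻ (typeFm Δ) θ∈
          v , h , pv = sound c c∈
      return (resp (HasType-agree V Δ h (typeFm-elim V Δ (subst (sat V w) θ≡ p))) pv)) ,
    λ ¬¬p → sat-stable V w (⋁ (map (typeFm Δ) cs)) (do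
      p ← ¬¬p
      c , h ← HasType-total V Δ w
      return (⋁-intro V w (map (typeFm Δ) cs) (∈-map⁺ (typeFm Δ) (complete c (∈-allVecs c) (w , h , p)))
        (typeFm-intro V Δ h))))

-- Finite grids inside T(ω,ω)

cell : ℕ × ℕ → World
cell (a , b) = pt a b

-- The cells `g i j` with fixed `j` need not lie in one row of the frame, only in rows that agree on
-- `Δ` at column 0. The fullness fields say that every type of such a row recurs along grid line
-- `j`; columns are treated alike.
record IsGrid (V : Val) (Δ : List Fm) {n : ℕ} (g : Fin n → Fin n → ℕ × ℕ) : Set where
  field
    row-coherent : ∀ i i′ j → Agree V Δ (pt 0 (proj₂ (g i j))) (pt 0 (proj₂ (g i′ j)))
    col-coherent : ∀ i j j′ → Agree V Δ (pt (proj₁ (g i j)) 0) (pt (proj₁ (g i j′)) 0)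
    row-full : ∀ i j a → ¬¬ (∃ λ i′ → Agree V Δ (pt a (proj₂ (g i j))) (cell (g i′ j)))
    col-full : ∀ i j b → ¬¬ (∃ λ j′ → Agree V Δ (pt (proj₁ (g i j)) b) (cell (g i j′)))
    covers : ∀ a b → ¬¬ (∃₂ λ i j → Agree V Δ (pt a b) (cell (g i j)))

module _ (Δ : List Fm) where

  Code : Set
  Code = Vec Bool (length Δ)

  codes : List (Code × Code)
  codes = cartesianProduct (allVecs (length Δ)) (allVecs (length Δ))

  -- One more line than there are codes: line 0 collects the lines outside the chosen classes (see Index).
  gridSize : ℕ
  gridSize = suc (length codes)

  code : Fin gridSize → Code × Code
  code zero = replicate _ false , replicate _ false
  code (suc j) = lookup codes j

  code-onto : ∀ u y → ∃ λ j → code j ≡ (u , y)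
  code-onto u y = suc (index m) , sym (lookup-index m)
    where m = ∈-cartesianProduct⁺ (∈-allVecs u) (∈-allVecs y)

  module _ (V : Val) where

    _≈_ : World → World → Set
    w ≈ v = Agree V Δ w v

    -- Each class of lines is repeated once for every shift, so that the class and the shift can be
    -- prescribed independently.
    representatives : (line : ℕ → World) → ¬¬ (Σ (Fin gridSize → ℕ) λ f →
      ∀ x y → ¬¬ (∃ λ j → (line x ≈ line (f j)) × proj₂ (code j) ≡ y))
    representatives line = do
      h ← ¬¬-choice gridSize pick
      return ((λ j → proj₁ (h j)) , λ x y → do
        u , hu ← HasType-total V Δ (line x)
        let j , e = code-onto u y
        return (j , HasType-agree V Δ hu
                      (subst (HasType V Δ _) (cong proj₁ e)
                        (proj₂ (h j) x (subst (HasType V Δ _) (sym (cong proj₁ e)) hu)))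
                  , cong proj₂ e))
      where
      pick : ∀ j → ¬¬ (Σ ℕ λ x → ∀ x′ → HasType V Δ (line x′) (proj₁ (code j)) →
                                        HasType V Δ (line x) (proj₁ (code j)))
      pick j = do
        inj₁ (x , h) ← em {∃ λ x → HasType V Δ (line x) (proj₁ (code j))}
          -- No line has this type, so 0 is an arbitrary value and the implication is vacuous.
          where inj₂ ¬∃ → return (0 , λ x′ h → ⊥-elim (¬∃ (x′ , h)))
        return (x , λ _ _ → h)

    InBlock : ℕ → ℕ → ℕ × ℕ → Set
    InBlock a b (a′ , b′) = (pt a 0 ≈ pt a′ 0) × (pt 0 b ≈ pt 0 b′)

    -- The cell with shifts x and y takes the type x ⊕ y whenever that type occurs in its
    -- block, so every line of the grid meets every type of each block it crosses.
    latinSquare : ¬¬ (Σ (Fin gridSize → Fin gridSize → ℕ × ℕ) (IsGrid V Δ))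
    latinSquare = do
      α , α-onto ← representatives (λ a → pt a 0)
      β , β-onto ← representatives (λ b → pt 0 b)
      h ← ¬¬-choice gridSize λ i → ¬¬-choice gridSize λ j → pick (α i) (β j) (shift i ⊕ shift j)
      return ((λ i j → proj₁ (h i j)) , grid α α-onto β β-onto (λ i j → proj₁ (h i j)) (λ i j → proj₂ (h i j)))
      where
      shift : Fin gridSize → Code
      shift i = proj₂ (code i)

      -- An implication, so that a suitable cell exists even when the type `c` is missing from the
      -- block.
      Good : ℕ → ℕ → Code → ℕ × ℕ → Set
      Good a b c q = InBlock a b q ×
        (∀ q′ → InBlock a b q′ → HasType V Δ (cell q′) c → HasType V Δ (cell q) c)

      pick : ∀ a b c → ¬¬ (Σ (ℕ × ℕ) (Good a b c))
      pick a b c = do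
        inj₁ (q , bl , h) ← em {∃ λ q → InBlock a b q × HasType V Δ (cell q) c}
          where inj₂ ¬∃ → return ((a , b) , (Agree-refl V Δ , Agree-refl V Δ) ,
                                   λ q bl h → ⊥-elim (¬∃ (q , bl , h)))
        return (q , bl , λ _ _ _ → h)

      module _ (α : Fin gridSize → ℕ)
               (α-onto : ∀ a x → ¬¬ (∃ λ i → (pt a 0 ≈ pt (α i) 0) × shift i ≡ x))
               (β : Fin gridSize → ℕ)
               (β-onto : ∀ b y → ¬¬ (∃ λ j → (pt 0 b ≈ pt 0 (β j)) × shift j ≡ y))
               (g : Fin gridSize → Fin gridSize → ℕ × ℕ)
               (good : ∀ i j → Good (α i) (β j) (shift i ⊕ shift j) (g i j)) where

        hits : ∀ a b i j c → pt a 0 ≈ pt (α i) 0 → pt 0 b ≈ pt 0 (β j) →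
               HasType V Δ (pt a b) c → shift i ⊕ shift j ≡ c → pt a b ≈ cell (g i j)
        hits a b i j c ea eb h refl = HasType-agree V Δ h
          (proj₂ (good i j) (a , b) (Agree-sym V Δ ea , Agree-sym V Δ eb) h)

        row : ∀ i j → pt 0 (β j) ≈ pt 0 (proj₂ (g i j))
        row i j = proj₂ (proj₁ (good i j))

        col : ∀ i j → pt (α i) 0 ≈ pt (proj₁ (g i j)) 0
        col i j = proj₁ (proj₁ (good i j))

        meets-row : ∀ a b j → pt 0 b ≈ pt 0 (β j) → ¬¬ (∃ λ i → pt a b ≈ cell (g i j))
        meets-row a b j eb = do
          c , h ← HasType-total V Δ (pt a b)
          -- This shift solves `shift i ⊕ shift j ≡ c` for the index `i`.
          i , ea , e ← α-onto a (c ⊕ shift j)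
          return (i , hits a b i j c ea eb h (trans (cong (_⊕ shift j) e) (⊕-cancelʳ c (shift j))))

        meets-col : ∀ a b i → pt a 0 ≈ pt (α i) 0 → ¬¬ (∃ λ j → pt a b ≈ cell (g i j))
        meets-col a b i ea = do
          c , h ← HasType-total V Δ (pt a b)
          j , eb , e ← β-onto b (shift i ⊕ c)
          return (j , hits a b i j c ea eb h (trans (cong (shift i ⊕_) e) (⊕-cancelˡ (shift i) c)))

        grid : IsGrid V Δ g
        grid = record
          { row-coherent = λ i i′ j → Agree-trans V Δ (Agree-sym V Δ (row i j)) (row i′ j)
          ; col-coherent = λ i j j′ → Agree-trans V Δ (Agree-sym V Δ (col i j)) (col i j′)
          ; row-full = λ i j a → meets-row a _ j (Agree-sym V Δ (row i j))
          ; col-full = λ i j b → meets-col _ b i (Agree-sym V Δ (col i j))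
          ; covers = λ a b → do
              j , eb , _ ← β-onto b (replicate _ false)
              i , e ← meets-row a b j eb
              return (i , j , e)
          }

-- Refining chains of equivalence relations

record Refining (E : ℕ → ℕ → ℕ → Set) : Set where
  field
    E-refl : ∀ i {x} → E i x x
    E-sym : ∀ i {x y} → E i x y → E i y x
    E-trans : ∀ i {x y z} → E i x y → E i y z → E i x z
    E-mono : ∀ i {x y} → E (suc i) x y → E i x y

Inequivalent : (ℕ → ℕ → Set) → ∀ {n} → (Fin n → ℕ) → Set
Inequivalent E f = ∀ i j → E (f i) (f j) → i ≡ j

module _ {E : ℕ → ℕ → ℕ → Set} (ref : Refining E) where
  open Refining ref

  extend : ∀ i {n x} {f : Fin n → ℕ} → Inequivalent (E i) f → (∀ l → ¬ E (suc i) x (f l)) →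
    Σ (Fin (suc n) → ℕ) (Inequivalent (E (suc i)))
  extend i {n} {x} {f} inj new = f′ , inj′
    where
    f′ : Fin (suc n) → ℕ
    f′ zero = x
    f′ (suc l) = f l
    inj′ : Inequivalent (E (suc i)) f′
    inj′ zero zero _ = refl
    inj′ zero (suc l) e = ⊥-elim (new l e)
    inj′ (suc l) zero e = ⊥-elim (new l (E-sym (suc i) e))
    inj′ (suc l) (suc l′) e = cong suc (inj l l′ (E-mono i e))

  -- If x and y are split at level i + 1 then at least one of them is new there.
  inequivalent-family : ∀ n → (∀ i → i < n → ¬ (∀ x y → E i x y → ¬¬ (E (suc i) x y))) →
    ¬¬ (Σ (Fin (suc n) → ℕ) (Inequivalent (E n)))
  inequivalent-family zero _ = return ((λ _ → 0) , λ { zero zero _ → refl })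
  inequivalent-family (suc n) strict = do
    f , inj ← inequivalent-family n (λ i i<n → strict i (≤-trans i<n (n≤1+n n)))
    x , y , e , ¬e ← split
    inj₁ (l , el) ← em {∃ λ l → E (suc n) x (f l)}
      where inj₂ ¬∃ → return (extend n inj (λ l el → ¬∃ (l , el)))
    -- Here `x` is old, so `y` must be new: since `x` and `y` are equivalent at level `n`, an old
    -- member equivalent to `y` would be the one equivalent to `x`, joining `x` and `y` at level
    -- `suc n`.
    return (extend n inj λ l′ el′ →
      let l≡l′ = inj l l′ (E-trans n (E-sym n (E-mono n el)) (E-trans n e (E-mono n el′)))
      in ¬e (E-trans (suc n) el (subst (λ l → E (suc n) (f l) y) (sym l≡l′) (E-sym (suc n) el′))))
    where
    split : ¬¬ (∃₂ λ x y → E n x y × ¬ E (suc n) x y)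
    split k = strict n ≤-refl λ x y e ¬e → k (x , y , e , ¬e)

  module _ (i : ℕ) {n : ℕ} (f : Fin (suc n) → ℕ) where

    -- For inequivalent `f` this partitions ℕ into `suc n` nonempty parts: the classes of the points
    -- `f (suc l)`, and the remainder, which contains `f zero`.
    Index : ℕ → Fin (suc n) → Set
    Index x zero = ∀ l → ¬ E i x (f (suc l))
    Index x (suc l) = E i x (f (suc l))

    Index-total : ∀ x → ¬¬ (∃ (Index x))
    Index-total x = do
      inj₁ (l , e) ← em {∃ λ l → E i x (f (suc l))}
        where inj₂ ¬∃ → return (zero , λ l e → ¬∃ (l , e))
      return (suc l , e)

    Index-resp : ∀ {x y} l → E i x y → Index x l → Index y l
    Index-resp zero e h l e′ = h l (E-trans i e e′)
    Index-resp (suc l) e h = E-trans i (E-sym i e) h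

    module _ (inj : Inequivalent (E i) f) where

      Index-hit : ∀ l → Index (f l) l
      Index-hit zero l e with () ← inj zero (suc l) e
      Index-hit (suc l) = E-refl i

      Index-unique : ∀ {x} l l′ → Index x l → Index x l′ → l ≡ l′
      Index-unique zero zero _ _ = refl
      Index-unique zero (suc l′) h h′ = ⊥-elim (h l′ h′)
      Index-unique (suc l) zero h h′ = ⊥-elim (h′ l h)
      Index-unique (suc l) (suc l′) h h′ = inj (suc l) (suc l′) (E-trans i (E-sym i h) h′)

-- Transferring a refutation along a substitution

subs : Fm → List Fm
subs (var n) = var n ∷ []
subs ⊥' = ⊥' ∷ []
subs (φ ⇒ ψ) = (φ ⇒ ψ) ∷ subs φ ++ subs ψ
subs (□₁ φ) = □₁ φ ∷ subs φ
subs (□₂ φ) = □₂ φ ∷ subs φ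

∈-subs : ∀ φ → φ ∈ subs φ
∈-subs (var n) = here refl
∈-subs ⊥' = here refl
∈-subs (φ ⇒ ψ) = here refl
∈-subs (□₁ φ) = here refl
∈-subs (□₂ φ) = here refl

-- All points of a row have the same R₁-successors.
□₁-row : ∀ V φ a a′ b → sat V (pt a b) (□₁ φ) → sat V (pt a′ b) (□₁ φ)
□₁-row V φ a a′ b h (pt c d) r = h (pt c d) r
□₁-row V φ a a′ b h t r = h t r

□₂-col : ∀ V φ a b b′ → sat V (pt a b) (□₂ φ) → sat V (pt a b′) (□₂ φ)
□₂-col V φ a b b′ h (pt c d) r = h (pt c d) r

-- A surjection from ℕ onto `Fin n`, given by its graph because its values are determined only
-- inside ¬¬.
record IsIndexing {n : ℕ} (idx : ℕ → Fin n → Set) : Set where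
  field
    total : ∀ x → ¬¬ (∃ (idx x))
    onto : ∀ i → ∃ λ x → idx x i
    unique : ∀ {x} i j → idx x i → idx x j → i ≡ j

module _ {n : ℕ} (V₀ : Val) (g : Fin n → Fin n → ℕ × ℕ) (col row : ℕ → Fin n → Set) where

  -- The valuation of `V₀` copied along the index relations; formulas defining it will form the
  -- substitution `σ`.
  Pullback : ℕ → World → Set
  Pullback p (pt a b) = ∃₂ λ i j → col a i × row b j × V₀ p (cell (g i j)) ≡ true
  Pullback p t = V₀ p t ≡ true

  module _ {V : Val} {Δ : List Fm} (isGrid : IsGrid V₀ Δ g) (colIx : IsIndexing col) (rowIx : IsIndexing row)
           {m : ℕ} {σ : ℕ → Fm} (hσ : ∀ p → p < m → ∀ w → Iff (sat V w (σ p)) (¬¬ (Pullback p w))) where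
    open IsGrid isGrid
    module C = IsIndexing colIx
    module R = IsIndexing rowIx

    -- The point `t` sees only itself, and the valuations match there.
    transfer-t : ∀ ψ → VarsBelow m ψ → Iff (sat V t (sub σ ψ)) (sat V₀ t ψ)
    transfer-t (var p) p<m = (λ s → ≡true-stable (proj₁ (hσ p p<m t) s)) , λ e → proj₂ (hσ p p<m t) (return e)
    transfer-t ⊥' _ = id , id
    transfer-t (φ ⇒ ψ) (vφ , vψ) with transfer-t φ vφ | transfer-t ψ vψ
    ... | f , g | f′ , g′ = (λ h → f′ ∘ h ∘ g) , λ h → g′ ∘ h ∘ f
    transfer-t (□₁ φ) vφ with transfer-t φ vφ
    ... | f , g = (λ { h t r → f (h t r) }) , λ { h t r → g (h t r) }
    transfer-t (□₂ φ) vφ with transfer-t φ vφ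
    ... | f , g = (λ { h t r → f (h t r) }) , λ { h t r → g (h t r) }

    -- Induction on `ψ`. In the box cases fullness of the grid matches each neighbour in `V₀` with a
    -- grid cell, and coherence carries a box from one cell of a grid line to the others.
    transfer : ∀ ψ → VarsBelow m ψ → (∀ δ → δ ∈ subs ψ → δ ∈ Δ) → ∀ {a b i j} → col a i → row b j →
      Iff (sat V (pt a b) (sub σ ψ)) (sat V₀ (cell (g i j)) ψ)
    transfer (var p) p<m _ {a} {b} {i} {j} ca rb =
      (λ s → ≡true-stable (do
        i′ , j′ , ca′ , rb′ , e ← proj₁ (hσ p p<m (pt a b)) s
        return (subst (λ i → V₀ p (cell (g i j)) ≡ true) (C.unique i′ i ca′ ca)
                 (subst (λ j → V₀ p (cell (g i′ j)) ≡ true) (R.unique j′ j rb′ rb) e)))) ,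
      λ e → proj₂ (hσ p p<m (pt a b)) (return (i , j , ca , rb , e))
    transfer ⊥' _ _ _ _ = id , id
    transfer (φ ⇒ ψ) (vφ , vψ) ⊆Δ ca rb
      with transfer φ vφ (λ δ → ⊆Δ δ ∘ there ∘ ∈-++⁺ˡ) ca rb | transfer ψ vψ (λ δ → ⊆Δ δ ∘ there ∘ ∈-++⁺ʳ (subs φ)) ca rb
    ... | f , g | f′ , g′ = (λ h → f′ ∘ h ∘ g) , λ h → g′ ∘ h ∘ f
    transfer (□₁ φ) vφ ⊆Δ {a} {b} {i} {j} ca rb = to , from
      where
      ih : ∀ {a i} → col a i → Iff (sat V (pt a b) (sub σ φ)) (sat V₀ (cell (g i j)) φ)
      ih ca = transfer φ vφ (λ δ → ⊆Δ δ ∘ there) ca rb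
      to : sat V (pt a b) (□₁ (sub σ φ)) → sat V₀ (cell (g i j)) (□₁ φ)
      to h t _ = proj₁ (transfer-t φ vφ) (h t tt)
      to h (pt a₁ _) refl = sat-stable V₀ _ φ (do
        i′ , ag ← row-full i j a₁
        let a′ , ca′ = C.onto i′
        return (proj₂ (ag φ (⊆Δ φ (there (∈-subs φ)))) (proj₁ (ih ca′) (h (pt a′ b) refl))))
      from : sat V₀ (cell (g i j)) (□₁ φ) → sat V (pt a b) (□₁ (sub σ φ))
      from h t _ = proj₂ (transfer-t φ vφ) (h t tt)
      from h (pt a₁ _) refl = sat-stable V _ (sub σ φ) (do
        i′ , ca′ ← C.total a₁
        -- The box is moved to column 0, where `row-coherent` compares the rows of the two cells.
        let h₀ = □₁-row V₀ φ _ 0 _ h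
            h₁ = proj₁ (row-coherent i i′ j (□₁ φ) (⊆Δ _ (here refl))) h₀
        return (proj₂ (ih ca′) (h₁ (cell (g i′ j)) refl)))
    transfer (□₂ φ) vφ ⊆Δ {a} {b} {i} {j} ca rb = to , from
      where
      ih : ∀ {b j} → row b j → Iff (sat V (pt a b) (sub σ φ)) (sat V₀ (cell (g i j)) φ)
      ih rb = transfer φ vφ (λ δ → ⊆Δ δ ∘ there) ca rb
      to : sat V (pt a b) (□₂ (sub σ φ)) → sat V₀ (cell (g i j)) (□₂ φ)
      to h (pt _ b₁) refl = sat-stable V₀ _ φ (do
        j′ , ag ← col-full i j b₁
        let b′ , rb′ = R.onto j′
        return (proj₂ (ag φ (⊆Δ φ (there (∈-subs φ)))) (proj₁ (ih rb′) (h (pt a b′) refl))))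
      from : sat V₀ (cell (g i j)) (□₂ φ) → sat V (pt a b) (□₂ (sub σ φ))
      from h (pt _ b₁) refl = sat-stable V _ (sub σ φ) (do
        j′ , rb′ ← R.total b₁
        let h₀ = □₂-col V₀ φ _ _ 0 h
            h₁ = proj₁ (col-coherent i j j′ (□₂ φ) (⊆Δ _ (here refl))) h₀
        return (proj₂ (ih rb′) (h₁ (cell (g i j′)) refl)))

-- Finite models

every : {A : Set} → (A → Bool) → List A → Bool
every f [] = true
every f (x ∷ xs) = if f x then every f xs else false

every-intro : {A : Set} (f : A → Bool) (xs : List A) → (∀ x → x ∈ xs → f x ≡ true) → every f xs ≡ true
every-intro f [] h = refl
every-intro f (x ∷ xs) h rewrite h x (here refl) = every-intro f xs (λ y → h y ∘ there)

every-elim : {A : Set} (f : A → Bool) (xs : List A) → every f xs ≡ true → ∀ x → x ∈ xs → f x ≡ true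
every-elim f (x ∷ xs) h y y∈ with f x in e
every-elim f (x ∷ xs) h y (here refl) | true = e
every-elim f (x ∷ xs) h y (there y∈) | true = every-elim f xs h y y∈

every-cong : {A : Set} (f g : A → Bool) (xs : List A) → (∀ x → x ∈ xs → f x ≡ g x) → every f xs ≡ every g xs
every-cong f g [] h = refl
every-cong f g (x ∷ xs) h rewrite h x (here refl) | every-cong f g xs (λ y → h y ∘ there) = refl

_≟ᵛ_ : ∀ {n} (u v : Vec Bool n) → Dec (u ≡ v)
_≟ᵛ_ = ≡-dec _≟ᵇ_

atom : ∀ {k} → Vec Bool k → ℕ → Bool
atom [] _ = false
atom (b ∷ c) zero = b
atom (b ∷ c) (suc n) = atom c n

colour : ∀ k → (ℕ → Bool) → Vec Bool k
colour zero v = []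
colour (suc k) v = v zero ∷ colour k (v ∘ suc)

atom-colour : ∀ {k n} v → n < k → atom (colour k v) n ≡ v n
atom-colour {suc k} {zero} v _ = refl
atom-colour {suc k} {suc n} v (s≤s n<k) = atom-colour (v ∘ suc) n<k

colour-cong : ∀ k {v v′ : ℕ → Bool} → (∀ n → n < k → v n ≡ v′ n) → colour k v ≡ colour k v′
colour-cong zero h = refl
colour-cong (suc k) h = cong₂ _∷_ (h zero (s≤s z≤n)) (colour-cong k λ n n<k → h (suc n) (s≤s n<k))

module _ (k : ℕ) where

  -- A cell (κ , γ , ρ) has colour κ and lies in column class γ and row class ρ.
  Cell : ℕ × ℕ → Set
  Cell (q , p) = Vec Bool k × Vec Bool q × Vec Bool p

  -- The relations are not stored, as they can be read off from equality of row or column classes. A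
  -- model of given dimensions is thus a sublist of a fixed finite list together with a colour for
  -- `t`.
  record FinModel : Set where
    constructor finModel
    field
      dims : ℕ × ℕ
      cells : List (Cell dims)
      top : Vec Bool k

  module _ (M : FinModel) where
    open FinModel M

    -- The point t is represented by nothing.
    Point : Set
    Point = Maybe (Cell dims)

    succ₁ succ₂ : Point → List Point
    succ₁ nothing = nothing ∷ []
    succ₁ (just (κ , γ , ρ)) = nothing ∷ map just (filter (λ c → ρ ≟ᵛ proj₂ (proj₂ c)) cells)
    succ₂ nothing = nothing ∷ []
    succ₂ (just (κ , γ , ρ)) = map just (filter (λ c → γ ≟ᵛ proj₁ (proj₂ c)) cells)

    points : List Point
    points = nothing ∷ map just cells

    value : Point → ℕ → Bool
    value nothing = atom top
    value (just (κ , _)) = atom κ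

    eval : Fm → Point → Bool
    eval (var n) x = value x n
    eval ⊥' x = false
    eval (φ ⇒ ψ) x = if eval φ x then eval ψ x else true
    eval (□₁ φ) x = every (eval φ) (succ₁ x)
    eval (□₂ φ) x = every (eval φ) (succ₂ x)

    filtered⊆points : ∀ {P : Cell dims → Set} (P? : ∀ c → Dec (P c)) {y} → y ∈ map just (filter P? cells) → y ∈ points
    filtered⊆points P? y∈ with _ , c∈ , refl ← ∈-map⁻ just y∈ = there (∈-map⁺ just (proj₁ (∈-filter⁻ P? c∈)))

    succ₁⊆points : ∀ x {y} → y ∈ succ₁ x → y ∈ points
    succ₁⊆points nothing (here refl) = here refl
    succ₁⊆points (just _) (here refl) = here refl
    succ₁⊆points (just _) (there y∈) = filtered⊆points _ y∈

    succ₂⊆points : ∀ x {y} → y ∈ succ₂ x → y ∈ points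
    succ₂⊆points nothing (here refl) = here refl
    succ₂⊆points (just _) y∈ = filtered⊆points _ y∈

    record IsBisimulation (V : Val) (Z : World → Point → Set) : Set where
      field
        atoms : ∀ {w x} → Z w x → ∀ n → n < k → V n w ≡ value x n
        forth₁ : ∀ {w x} → Z w x → ∀ v → TR₁ w v → ¬¬ (∃ λ y → y ∈ succ₁ x × Z v y)
        back₁ : ∀ {w x} → Z w x → ∀ y → y ∈ succ₁ x → ¬¬ (∃ λ v → TR₁ w v × Z v y)
        forth₂ : ∀ {w x} → Z w x → ∀ v → TR₂ w v → ¬¬ (∃ λ y → y ∈ succ₂ x × Z v y)
        back₂ : ∀ {w x} → Z w x → ∀ y → y ∈ succ₂ x → ¬¬ (∃ λ v → TR₂ w v × Z v y)

    module _ {V : Val} {Z : World → Point → Set} (bisim : IsBisimulation V Z) where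
      open IsBisimulation bisim

      -- Bisimulation invariance by induction on `φ`. Witnesses under ¬¬ suffice, because both `sat`
      -- and equality with `true` are stable.
      bisimilar-eval : ∀ φ → VarsBelow k φ → ∀ {w x} → Z w x → Iff (sat V w φ) (eval φ x ≡ true)
      bisimilar-eval (var n) n<k z rewrite atoms z n n<k = id , id
      bisimilar-eval ⊥' _ z = (λ ()) , λ ()
      bisimilar-eval (φ ⇒ ψ) (vφ , vψ) {w} {x} z
        with eval φ x | bisimilar-eval φ vφ z | bisimilar-eval ψ vψ z
      ... | true | f , g | f′ , g′ = (λ h → f′ (h (g refl))) , λ e _ → g′ e
      ... | false | f , g | f′ , g′ = (λ _ → refl) , λ { _ p → case-absurd (f p) }
        where case-absurd : false ≡ true → sat V w ψ
              case-absurd ()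
      bisimilar-eval (□₁ φ) vφ {w} {x} z =
        (λ h → every-intro (eval φ) (succ₁ x) λ y y∈ → ≡true-stable (do
          v , r , z′ ← back₁ z y y∈
          return (proj₁ (bisimilar-eval φ vφ z′) (h v r)))) ,
        λ e v r → sat-stable V v φ (do
          y , y∈ , z′ ← forth₁ z v r
          return (proj₂ (bisimilar-eval φ vφ z′) (every-elim (eval φ) (succ₁ x) e y y∈)))
      bisimilar-eval (□₂ φ) vφ {w} {x} z =
        (λ h → every-intro (eval φ) (succ₂ x) λ y y∈ → ≡true-stable (do
          v , r , z′ ← back₂ z y y∈
          return (proj₁ (bisimilar-eval φ vφ z′) (h v r)))) ,
        λ e v r → sat-stable V v φ (do
          y , y∈ , z′ ← forth₂ z v r
          return (proj₂ (bisimilar-eval φ vφ z′) (every-elim (eval φ) (succ₂ x) e y y∈)))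

  Agrees : Val → World → (M : FinModel) → Point M → Set
  Agrees V w M x = ∀ φ → VarsBelow k φ → Iff (sat V w φ) (eval M φ x ≡ true)

  -- Enumeration of finite models with given dimensions

  allCells : ∀ d → List (Cell d)
  allCells (q , p) = cartesianProduct (allVecs k) (cartesianProduct (allVecs q) (allVecs p))

  ∈-allCells : ∀ d (c : Cell d) → c ∈ allCells d
  ∈-allCells d (κ , γ , ρ) = ∈-cartesianProduct⁺ (∈-allVecs κ) (∈-cartesianProduct⁺ (∈-allVecs γ) (∈-allVecs ρ))

  finModels : List (ℕ × ℕ) → List FinModel
  finModels = concatMap λ d → cartesianProductWith (finModel d) (sublists (allCells d)) (allVecs k)

  ∈-finModels : ∀ {ds d cs} c → d ∈ ds → cs ∈ sublists (allCells d) → finModel d cs c ∈ finModels ds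
  ∈-finModels {ds} {d} c d∈ cs∈ =
    ∈-concatMap⁺ _ {xs = ds} (lose d∈ (∈-cartesianProductWith⁺ (finModel d) cs∈ (∈-allVecs c)))

-- Finitely many formulas up to equivalence in finitely many finite models

module _ {A : Set} {n : ℕ} (code : A → Vec Bool n) (step : List A → List A) where

  Saturated : List A → Set
  Saturated reps = ∀ a → a ∈ step reps → code a ∈ map code reps

  -- Local tabularity asks for an actual list, so the representatives are computed outright. `U`
  -- contains all codes still missing; each added representative removes its code from `U`, which
  -- bounds the number of rounds.
  saturate : ∀ fuel U reps → length U < fuel →
    (∀ a → code a ∈ U ⊎ code a ∈ map code reps) → Σ (List A) Saturated
  saturate (suc fuel) U reps (s≤s U≤) covered
    with all? (λ a → any? (code a ≟ᵛ_) (map code reps)) (step reps)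
  ... | yes closed = reps , λ a → All-lookup closed
  ... | no ¬closed with find (¬All⇒Any¬ (λ a → any? (code a ≟ᵛ_) (map code reps)) _ ¬closed)
  ... | a , _ , new with covered a
  ... | inj₂ old = ⊥-elim (new old)
  ... | inj₁ a∈U = saturate fuel (filter other? U) (a ∷ reps)
          (<-≤-trans (filter-notAll other? U (lose a∈U λ ne → ne refl)) U≤) covered′
    where
    other? : (v : Vec Bool n) → Dec (¬ (v ≡ code a))
    other? v = ¬? (v ≟ᵛ code a)
    covered′ : ∀ a′ → code a′ ∈ filter other? U ⊎ code a′ ∈ map code (a ∷ reps)
    covered′ a′ with code a′ ≟ᵛ code a | covered a′
    ... | yes e | _ = inj₂ (here e)
    ... | no _ | inj₂ old = inj₂ (there old)
    ... | no ne | inj₁ a′∈U = inj₁ (∈-filter⁺ other? a′∈U ne)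

map-≡⁻ : {A : Set} {f g : A → Bool} (xs : List A) → mapᵛ f (fromList xs) ≡ mapᵛ g (fromList xs) →
  ∀ x → x ∈ xs → f x ≡ g x
map-≡⁻ (x ∷ xs) e _ (here refl) = proj₁ (∷-injective e)
map-≡⁻ (x ∷ xs) e y (there y∈) = map-≡⁻ xs (proj₂ (∷-injective e)) y y∈

module _ (k : ℕ) (Ms : List (FinModel k)) where

  Pointed : Set
  Pointed = Σ (FinModel k) (Point k)

  pointed : List Pointed
  pointed = concatMap (λ M → map (M ,_) (points k M)) Ms

  ∈-pointed⁺ : ∀ {M x} → M ∈ Ms → x ∈ points k M → (M , x) ∈ pointed
  ∈-pointed⁺ {M} M∈ x∈ = ∈-concatMap⁺ _ {xs = Ms} (lose M∈ (∈-map⁺ (M ,_) x∈))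

  Small : Set
  Small = Σ Fm (VarsBelow k)

  truths : Fm → Vec Bool (length pointed)
  truths φ = mapᵛ (λ Mx → eval k (proj₁ Mx) φ (proj₂ Mx)) (fromList pointed)

  Equiv : Fm → Fm → Set
  Equiv φ ψ = ∀ M x → M ∈ Ms → x ∈ points k M → eval k M φ x ≡ eval k M ψ x

  truths⇒Equiv : ∀ φ ψ → truths φ ≡ truths ψ → Equiv φ ψ
  truths⇒Equiv _ _ e M x M∈ x∈ = map-≡⁻ pointed e (M , x) (∈-pointed⁺ M∈ x∈)

  vars′ : List Small
  vars′ = map (λ i → var (toℕ i) , toℕ<n i) (allFin k)

  _⇒′_ : Small → Small → Small
  (φ , vφ) ⇒′ (ψ , vψ) = φ ⇒ ψ , vφ , vψ

  □₁′ □₂′ : Small → Small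
  □₁′ (φ , vφ) = □₁ φ , vφ
  □₂′ (φ , vφ) = □₂ φ , vφ

  step : List Small → List Small
  step rs = (⊥' , tt) ∷ vars′ ++ cartesianProductWith _⇒′_ rs rs ++ map □₁′ rs ++ map □₂′ rs

  saturated : Σ (List Small) (Saturated (truths ∘ proj₁) step)
  saturated = saturate (truths ∘ proj₁) step _ (allVecs _) [] ≤-refl λ a → inj₁ (∈-allVecs _)

  module _ (reps : List Small) (sat-reps : Saturated (truths ∘ proj₁) step reps) where

    in-step : ∀ a → a ∈ step reps → ∃ λ b → b ∈ reps × Equiv (proj₁ a) (proj₁ b)
    in-step a a∈ with ∈-map⁻ (truths ∘ proj₁) (sat-reps a a∈)
    ... | b , b∈ , e = b , b∈ , truths⇒Equiv (proj₁ a) (proj₁ b) e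

    -- Immediate subformulas are replaced by their representatives; the result is one of the
    -- formulas in `step reps`, so saturation applies.
    represented : ∀ φ → VarsBelow k φ → ∃ λ b → b ∈ reps × Equiv φ (proj₁ b)
    represented (var n) n<k =
      subst (λ n → ∃ λ b → b ∈ reps × Equiv (var n) (proj₁ b)) (toℕ-fromℕ< n<k)
        (in-step _ (there (∈-++⁺ˡ (∈-map⁺ _ (∈-allFin (fromℕ< n<k))))))
    represented ⊥' _ = in-step (⊥' , tt) (here refl)
    represented (φ ⇒ ψ) (vφ , vψ) with represented φ vφ | represented ψ vψ
    ... | a , a∈ , ea | b , b∈ , eb
      with in-step (a ⇒′ b) (there (∈-++⁺ʳ vars′ (∈-++⁺ˡ (∈-cartesianProductWith⁺ _⇒′_ a∈ b∈))))
    ... | c , c∈ , ec = c , c∈ , λ M x M∈ x∈ →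
      trans (cong₂ (λ p q → if p then q else true) (ea M x M∈ x∈) (eb M x M∈ x∈)) (ec M x M∈ x∈)
    represented (□₁ φ) vφ with represented φ vφ
    ... | a , a∈ , ea
      with in-step (□₁′ a) (there (∈-++⁺ʳ vars′ (∈-++⁺ʳ (cartesianProductWith _⇒′_ reps reps) (∈-++⁺ˡ (∈-map⁺ □₁′ a∈)))))
    ... | c , c∈ , ec = c , c∈ , λ M x M∈ x∈ →
      -- Successors are again points of the model, so the equivalence of the subformulas holds at
      -- them too.
      trans (every-cong _ _ (succ₁ k M x) λ y y∈ → ea M y M∈ (succ₁⊆points k M x y∈)) (ec M x M∈ x∈)
    represented (□₂ φ) vφ with represented φ vφ
    ... | a , a∈ , ea
      with in-step (□₂′ a) (there (∈-++⁺ʳ vars′ (∈-++⁺ʳ (cartesianProductWith _⇒′_ reps reps) (∈-++⁺ʳ (map □₁′ reps) (∈-map⁺ □₂′ a∈)))))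
    ... | c , c∈ , ec = c , c∈ , λ M x M∈ x∈ →
      trans (every-cong _ _ (succ₂ k M x) λ y y∈ → ea M y M∈ (succ₂⊆points k M x y∈)) (ec M x M∈ x∈)

-- Refinement of rows and columns

module _ (k : ℕ) where

  vars : List Fm
  vars = map var (upTo k)

  -- Defines t unless every point is coloured like t.
  τ : Fm
  τ = ⋁ (map (λ c → □₂ (□₁ (typeFm vars c))) (allVecs (length vars)))

  -- Diamonds relativised to the worlds where `τ` fails, which in the nontrivial case are exactly
  -- those other than `t`.
  dia₁ dia₂ : Fm → Fm
  dia₁ φ = ¬' (□₁ (¬' τ ⇒ ¬' φ))
  dia₂ φ = ¬' (□₂ (¬' τ ⇒ ¬' φ))

  -- Alternating refinement in the order `rowFms 0`, `colFms 0`, `rowFms 1`, `colFms 1` and so on: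
  -- each new formula says that a type over the variables and the latest formulas of the other kind
  -- occurs in the line. Earlier formulas are kept, so the partitions refine.
  rowFms colFms : ℕ → List Fm
  rowFms zero = []
  rowFms (suc i) = rowFms i ++ map dia₁ (types (vars ++ colFms i))
  colFms zero = map dia₂ (types (vars ++ rowFms zero))
  colFms (suc i) = colFms i ++ map dia₂ (types (vars ++ rowFms (suc i)))

  rowFms-step : ∀ i {φ} → φ ∈ types (vars ++ colFms i) → dia₁ φ ∈ rowFms (suc i)
  rowFms-step i φ∈ = ∈-++⁺ʳ (rowFms i) (∈-map⁺ dia₁ φ∈)

  colFms-step : ∀ i {φ} → φ ∈ types (vars ++ rowFms i) → dia₂ φ ∈ colFms i
  colFms-step zero φ∈ = ∈-map⁺ dia₂ φ∈
  colFms-step (suc i) φ∈ = ∈-++⁺ʳ (colFms i) (∈-map⁺ dia₂ φ∈)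

  rowFms-dia : ∀ i {δ} → δ ∈ rowFms i → ∃ λ φ → δ ≡ dia₁ φ
  rowFms-dia (suc i) δ∈ with ∈-++⁻ (rowFms i) δ∈
  ... | inj₁ δ∈′ = rowFms-dia i δ∈′
  ... | inj₂ δ∈′ with ∈-map⁻ dia₁ δ∈′
  ... | φ , _ , e = φ , e

  colFms-dia : ∀ i {δ} → δ ∈ colFms i → ∃ λ φ → δ ≡ dia₂ φ
  colFms-dia zero δ∈ with ∈-map⁻ dia₂ δ∈
  ... | φ , _ , e = φ , e
  colFms-dia (suc i) δ∈ with ∈-++⁻ (colFms i) δ∈
  ... | inj₁ δ∈′ = colFms-dia i δ∈′
  ... | inj₂ δ∈′ with ∈-map⁻ dia₂ δ∈′
  ... | φ , _ , e = φ , e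

  dims : ℕ → ℕ → ℕ × ℕ
  dims i j = length (colFms j) , length (rowFms i)

  module _ (V : Val) where

    rowFms-invariant : ∀ i a a′ b → Agree V (rowFms i) (pt a b) (pt a′ b)
    rowFms-invariant i a a′ b δ δ∈ with φ , refl ← rowFms-dia i δ∈ = go a a′ , go a′ a
      where go : ∀ a a′ → sat V (pt a b) (dia₁ φ) → sat V (pt a′ b) (dia₁ φ)
            go a a′ h n = h (□₁-row V (¬' τ ⇒ ¬' φ) a′ a b n)

    colFms-invariant : ∀ i a b b′ → Agree V (colFms i) (pt a b) (pt a b′)
    colFms-invariant i a b b′ δ δ∈ with φ , refl ← colFms-dia i δ∈ = go b b′ , go b′ b
      where go : ∀ b b′ → sat V (pt a b) (dia₂ φ) → sat V (pt a b′) (dia₂ φ)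
            go b b′ h n = h (□₂-col V (¬' τ ⇒ ¬' φ) a b′ b n)

    RowEq ColEq : ℕ → ℕ → ℕ → Set
    RowEq i b b′ = Agree V (rowFms i) (pt 0 b) (pt 0 b′)
    ColEq i a a′ = Agree V (colFms i) (pt a 0) (pt a′ 0)

    row-refining : Refining RowEq
    row-refining = record
      { E-refl = λ i → Agree-refl V (rowFms i)
      ; E-sym = λ i → Agree-sym V (rowFms i)
      ; E-trans = λ i → Agree-trans V (rowFms i)
      ; E-mono = λ i h δ δ∈ → h δ (∈-++⁺ˡ δ∈) }

    col-refining : Refining ColEq
    col-refining = record
      { E-refl = λ i → Agree-refl V (colFms i)
      ; E-sym = λ i → Agree-sym V (colFms i)
      ; E-trans = λ i → Agree-trans V (colFms i)
      ; E-mono = λ i h δ δ∈ → h δ (∈-++⁺ˡ δ∈) }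

    Trivial : Set
    Trivial = ∀ w n → n < k → V n w ≡ V n t

    Agree-vars : ∀ {w v} → Agree V vars w v → ∀ n → n < k → V n w ≡ V n v
    Agree-vars h n n<k = ≡true-ext (h (var n) (∈-map⁺ var (∈-upTo⁺ n<k)))

    τ-top : sat V t τ
    τ-top = sat-stable V t τ (do
      c , h ← HasType-total V vars t
      return (⋁-intro V t _ (∈-map⁺ _ (∈-allVecs c)) λ { t _ t _ → typeFm-intro V vars h }))

    module _ (nontrivial : ¬ Trivial) where

      -- From a grid point, R₂ followed by R₁ reaches every world, so `τ` there would force a single
      -- colour throughout.
      τ-grid : ∀ a b → ¬ sat V (pt a b) τ
      τ-grid a b s = ⋁-elim V (pt a b) _ s λ { (_ , φ∈ , h) → nontrivial (trivial φ∈ h) }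
        where
        trivial : ∀ {φ} → φ ∈ map (λ c → □₂ (□₁ (typeFm vars c))) (allVecs (length vars)) →
                  sat V (pt a b) φ → Trivial
        trivial φ∈ h with c , _ , refl ← ∈-map⁻ (λ c → □₂ (□₁ (typeFm vars c))) φ∈ = λ
          { t _ _ → refl
          ; (pt a′ b′) → Agree-vars (HasType-agree V vars
              (typeFm-elim V vars (h (pt a b′) refl (pt a′ b′) refl))
              (typeFm-elim V vars (h (pt a b′) refl t tt))) }

      dia₁-intro : ∀ φ a a′ b → sat V (pt a′ b) φ → sat V (pt a b) (dia₁ φ)
      dia₁-intro φ a a′ b s n = n (pt a′ b) refl (τ-grid a′ b) s

      dia₁-elim : ∀ φ a b → sat V (pt a b) (dia₁ φ) → ¬¬ (∃ λ a′ → sat V (pt a′ b) φ)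
      dia₁-elim φ a b h n = h λ { (pt a′ _) refl _ s → n (a′ , s) ; t _ ¬τ _ → ¬τ τ-top }

      dia₂-intro : ∀ φ a b b′ → sat V (pt a b′) φ → sat V (pt a b) (dia₂ φ)
      dia₂-intro φ a b b′ s n = n (pt a b′) refl (τ-grid a b′) s

      dia₂-elim : ∀ φ a b → sat V (pt a b) (dia₂ φ) → ¬¬ (∃ λ b′ → sat V (pt a b′) φ)
      dia₂-elim φ a b h n = h λ { (pt _ b′) refl _ s → n (b′ , s) }

      -- The type of the given point yields a `dia₁` formula from `rowFms (suc i)`, which then holds
      -- in the other row as well.
      row-step : ∀ i {b b′} → RowEq (suc i) b b′ → ∀ a →
        ¬¬ (∃ λ a′ → Agree V (vars ++ colFms i) (pt a b) (pt a′ b′))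
      row-step i {b} {b′} e a = do
        let Δ = vars ++ colFms i
        c , h ← HasType-total V Δ (pt a b)
        let s = dia₁-intro (typeFm Δ c) 0 a b (typeFm-intro V Δ h)
        a′ , s′ ← dia₁-elim (typeFm Δ c) 0 b′
                    (proj₁ (e (dia₁ (typeFm Δ c)) (rowFms-step i (∈-map⁺ (typeFm Δ) (∈-allVecs c)))) s)
        return (a′ , HasType-agree V Δ h (typeFm-elim V Δ s′))

      -- The index does not shift here, because `colFms i` is already built over `rowFms i`.
      col-step : ∀ i {a a′} → ColEq i a a′ → ∀ b →
        ¬¬ (∃ λ b′ → Agree V (vars ++ rowFms i) (pt a b) (pt a′ b′))
      col-step i {a} {a′} e b = do
        let Δ = vars ++ rowFms i
        c , h ← HasType-total V Δ (pt a b)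
        let s = dia₂-intro (typeFm Δ c) a 0 b (typeFm-intro V Δ h)
        b′ , s′ ← dia₂-elim (typeFm Δ c) a′ 0
                    (proj₁ (e (dia₂ (typeFm Δ c)) (colFms-step i (∈-map⁺ (typeFm Δ) (∈-allVecs c)))) s)
        return (b′ , HasType-agree V Δ h (typeFm-elim V Δ s′))

    -- What the back conditions need for the quotient by row classes of level `i` and column classes
    -- of level `j`.
    record Stable (i j : ℕ) : Set where
      field
        rowStep : ∀ b b′ → RowEq i b b′ → ∀ a → ¬¬ (∃ λ a′ → Agree V (vars ++ colFms j) (pt a b) (pt a′ b′))
        colStep : ∀ a a′ → ColEq j a a′ → ∀ b → ¬¬ (∃ λ b′ → Agree V (vars ++ rowFms i) (pt a b) (pt a′ b′))

    onePoint : FinModel k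
    onePoint = finModel (0 , 0) [] (colour k λ n → V n t)

    -- Treats together the two cases in which one point suffices: the world `t`, and all worlds of a
    -- trivially coloured model.
    Collapsed : World → Point k onePoint → Set
    Collapsed w x = x ≡ nothing × (w ≡ t ⊎ Trivial)

    Collapsed-bisimulation : IsBisimulation k onePoint V Collapsed
    Collapsed-bisimulation = record
      { atoms = λ { (refl , inj₁ refl) n n<k → sym (atom-colour _ n<k)
                  ; (refl , inj₂ triv) n n<k → trans (triv _ n n<k) (sym (atom-colour _ n<k)) }
      ; forth₁ = λ { (refl , inj₁ refl) t _ → return (nothing , here refl , refl , inj₁ refl)
                   ; (refl , inj₂ triv) _ _ → return (nothing , here refl , refl , inj₂ triv) }
      ; back₁ = λ { {pt a b} (refl , c) _ (here refl) → return (pt a b , refl , refl , c)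
                  ; {t} (refl , c) _ (here refl) → return (t , tt , refl , c) }
      ; forth₂ = λ { (refl , inj₁ refl) t _ → return (nothing , here refl , refl , inj₁ refl)
                   ; (refl , inj₂ triv) _ _ → return (nothing , here refl , refl , inj₂ triv) }
      ; back₂ = λ { {pt a b} (refl , c) _ (here refl) → return (pt a b , refl , refl , c)
                  ; {t} (refl , c) _ (here refl) → return (t , tt , refl , c) } }

    collapsed-model : ∀ ds → (0 , 0) ∈ ds → ∀ w → w ≡ t ⊎ Trivial → ¬¬ (∃₂ λ M x →
      M ∈ finModels k ds × x ∈ points k M × Agrees k V w M x)
    collapsed-model ds d∈ w c = return (onePoint , nothing , ∈-finModels k {ds} _ d∈ (empty∈ (allCells k (0 , 0))) , here refl ,
      λ φ vφ → bisimilar-eval k onePoint Collapsed-bisimulation φ vφ (refl , c))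
      where
      empty∈ : {A : Set} (xs : List A) → [] ∈ sublists xs
      empty∈ [] = here refl
      empty∈ (x ∷ xs) = ∈-++⁺ʳ (map (x ∷_) (sublists xs)) (empty∈ xs)

    -- The quotient by a stable pair of partitions

    module _ {i j : ℕ} (stable : Stable i j) where
      open Stable stable

      Realizes : ℕ → ℕ → Cell k (dims i j) → Set
      Realizes a b (κ , γ , ρ) = κ ≡ colour k (λ n → V n (pt a b)) ×
        HasType V (colFms j) (pt a b) γ × HasType V (rowFms i) (pt a b) ρ

      realized : ∀ a b → ¬¬ (∃ (Realizes a b))
      realized a b = do
        γ , hγ ← HasType-total V (colFms j) (pt a b)
        ρ , hρ ← HasType-total V (rowFms i) (pt a b)
        return ((_ , γ , ρ) , refl , hγ , hρ)

      module _ (cs : List (Cell k (dims i j))) (sound : ∀ c → c ∈ cs → ∃₂ λ a b → Realizes a b c)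
               (complete : ∀ a b c → Realizes a b c → c ∈ cs) where

        quotient : FinModel k
        quotient = finModel (dims i j) cs (colour k λ n → V n t)

        _~_ : World → Point k quotient → Set
        pt a b ~ just c = Realizes a b c
        pt a b ~ nothing = ⊥
        t ~ just c = ⊥
        t ~ nothing = ⊤

        atoms : ∀ {w x} → w ~ x → ∀ n → n < k → V n w ≡ value k quotient x n
        atoms {pt a b} {just _} (refl , _) n n<k = sym (atom-colour _ n<k)
        atoms {t} {nothing} _ n n<k = sym (atom-colour _ n<k)

        same-colour : ∀ {Δ w v} → Agree V (vars ++ Δ) w v → colour k (λ n → V n w) ≡ colour k (λ n → V n v)
        same-colour ag = colour-cong k (Agree-vars λ δ → ag δ ∘ ∈-++⁺ˡ)

        forth₁ : ∀ {w x} → w ~ x → ∀ v → TR₁ w v → ¬¬ (∃ λ y → y ∈ succ₁ k quotient x × v ~ y)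
        forth₁ {pt a b} {just (κ , γ , ρ)} (_ , _ , hρ) (pt a′ _) refl = do
          γ′ , hγ′ ← HasType-total V (colFms j) (pt a′ b)
          let z = refl , hγ′ , HasType-resp V (rowFms i) (rowFms-invariant i a a′ b) hρ
          return (just (_ , γ′ , ρ) , there (∈-map⁺ just (∈-filter⁺ _ (complete a′ b _ z) refl)) , z)
        forth₁ {pt a b} {just _} _ t _ = return (nothing , here refl , tt)
        forth₁ {t} {nothing} _ t _ = return (nothing , here refl , tt)

        forth₂ : ∀ {w x} → w ~ x → ∀ v → TR₂ w v → ¬¬ (∃ λ y → y ∈ succ₂ k quotient x × v ~ y)
        forth₂ {pt a b} {just (κ , γ , ρ)} (_ , hγ , _) (pt _ b′) refl = do
          ρ′ , hρ′ ← HasType-total V (rowFms i) (pt a b′)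
          let z = refl , HasType-resp V (colFms j) (colFms-invariant j a b b′) hγ , hρ′
          return (just (_ , γ , ρ′) , ∈-map⁺ just (∈-filter⁺ _ (complete a b′ _ z) refl) , z)
        forth₂ {t} {nothing} _ t _ = return (nothing , here refl , tt)

        back₁ : ∀ {w x} → w ~ x → ∀ y → y ∈ succ₁ k quotient x → ¬¬ (∃ λ v → TR₁ w v × v ~ y)
        back₁ {pt a b} {just (κ , γ , ρ)} _ _ (here refl) = return (t , tt , tt)
        back₁ {pt a b} {just (κ , γ , ρ)} (_ , _ , hρ) y (there y∈)
          with (κ′ , γ′ , _) , c∈ , refl ← ∈-map⁻ just y∈
          with c∈′ , refl ← ∈-filter⁻ (λ c → ρ ≟ᵛ proj₂ (proj₂ c)) c∈
          with a₀ , b₀ , refl , hγ₀ , hρ₀ ← sound _ c∈′ = do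
            -- The target cell was realised at `pt a₀ b₀`, possibly in another row. That row has the
            -- same class as row `b`, so stability finds the same colour and column class in row
            -- `b`.
            a′ , ag ← rowStep b₀ b (to-origin a₀ b₀ a b (HasType-agree V (rowFms i) hρ₀ hρ)) a₀
            return (pt a′ b , refl , same-colour ag ,
              HasType-resp V (colFms j) (λ δ → ag δ ∘ ∈-++⁺ʳ vars) hγ₀ ,
              HasType-resp V (rowFms i) (rowFms-invariant i a a′ b) hρ)
          where
          to-origin : ∀ a₀ b₀ a b → Agree V (rowFms i) (pt a₀ b₀) (pt a b) → RowEq i b₀ b
          to-origin a₀ b₀ a b e = Agree-trans V (rowFms i) (rowFms-invariant i 0 a₀ b₀)
            (Agree-trans V (rowFms i) e (rowFms-invariant i a 0 b))
        back₁ {t} {nothing} _ y (here refl) = return (t , tt , tt)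

        back₂ : ∀ {w x} → w ~ x → ∀ y → y ∈ succ₂ k quotient x → ¬¬ (∃ λ v → TR₂ w v × v ~ y)
        back₂ {pt a b} {just (κ , γ , ρ)} (_ , hγ , _) y y∈
          with (κ′ , _ , ρ′) , c∈ , refl ← ∈-map⁻ just y∈
          with c∈′ , refl ← ∈-filter⁻ (λ c → γ ≟ᵛ proj₁ (proj₂ c)) c∈
          with a₀ , b₀ , refl , hγ₀ , hρ₀ ← sound _ c∈′ = do
            b′ , ag ← colStep a₀ a (to-origin a₀ b₀ a b (HasType-agree V (colFms j) hγ₀ hγ)) b₀
            return (pt a b′ , refl , same-colour ag ,
              HasType-resp V (colFms j) (colFms-invariant j a b b′) hγ ,
              HasType-resp V (rowFms i) (λ δ → ag δ ∘ ∈-++⁺ʳ vars) hρ₀)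
          where
          to-origin : ∀ a₀ b₀ a b → Agree V (colFms j) (pt a₀ b₀) (pt a b) → ColEq j a₀ a
          to-origin a₀ b₀ a b e = Agree-trans V (colFms j) (colFms-invariant j a₀ 0 b₀)
            (Agree-trans V (colFms j) e (colFms-invariant j a b 0))
        back₂ {t} {nothing} _ y (here refl) = return (t , tt , tt)

        quotient-bisimulation : IsBisimulation k quotient V _~_
        quotient-bisimulation = record
          { atoms = λ {w} {x} → atoms {w} {x} ; forth₁ = λ {w} {x} → forth₁ {w} {x}
          ; back₁ = λ {w} {x} → back₁ {w} {x} ; forth₂ = λ {w} {x} → forth₂ {w} {x}
          ; back₂ = λ {w} {x} → back₂ {w} {x} }

      stable-model : ∀ ds → dims i j ∈ ds → ∀ a b → ¬¬ (∃₂ λ M x →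
        M ∈ finModels k ds × x ∈ points k M × Agrees k V (pt a b) M x)
      stable-model ds d∈ a b = do
        cs , cs∈ , sound , complete ← comprehension (λ c → ∃₂ λ a b → Realizes a b c) (allCells k (dims i j))
        let complete′ = λ a b c z → complete c (∈-allCells k (dims i j) c) (a , b , z)
        c , z ← realized a b
        return (quotient cs sound complete′ , just c , ∈-finModels k {ds} _ d∈ cs∈ , there (∈-map⁺ just (complete′ a b c z)) ,
          λ φ vφ → bisimilar-eval k _ (quotient-bisimulation cs sound complete′) φ vφ {pt a b} {just c} z)

    module _ (nontrivial : ¬ Trivial) where

      -- Columns of level `i` already respect rows of level `i`; the hypothesis lifts row
      -- equivalence to the level that `row-step` requires.
      stable-rows : ∀ i → (∀ b b′ → RowEq i b b′ → ¬¬ (RowEq (suc i) b b′)) → Stable i i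
      stable-rows i h = record
        { rowStep = λ b b′ e a → h b b′ e >>= λ e′ → row-step nontrivial i e′ a
        ; colStep = λ a a′ → col-step nontrivial i }

      -- The rows are taken one level ahead: `row-step` leads from level `suc i` to columns of level
      -- `i`, and the hypothesis closes the cycle.
      stable-cols : ∀ i → (∀ a a′ → ColEq i a a′ → ¬¬ (ColEq (suc i) a a′)) → Stable (suc i) i
      stable-cols i h = record
        { rowStep = λ b b′ → row-step nontrivial i
        ; colStep = λ a a′ e b → h a a′ e >>= λ e′ → col-step nontrivial (suc i) e′ b }

  -- Refuting an instance on a model with many separated lines

  separators : ℕ → List Fm
  separators n = τ ∷ rowFms n ++ colFms n

  module _ (V : Val) (nontrivial : ¬ Trivial V) (φ₀ : Fm) {m : ℕ} (below : VarsBelow m φ₀)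
           (V₀ : Val) (w₀ : World) (refuted : ¬ sat V₀ w₀ φ₀) where

    Δ₀ : List Fm
    Δ₀ = subs φ₀

    -- Chosen so that `suc N` is `gridSize Δ₀`: strict refinement at the levels below `N` yields
    -- `suc N` inequivalent lines.
    N : ℕ
    N = length (codes Δ₀)

    -- The separated classes index a Latin square for `V₀`. The pulled-back valuation is invariant
    -- under agreement on `separators N`, hence definable, and the corresponding substitution
    -- instance of `φ₀` fails.
    separated⇒refuted : (f g : Fin (suc N) → ℕ) →
      Inequivalent (ColEq V N) f → Inequivalent (RowEq V N) g →
      ¬ (∀ σ → σ ∈ substitutions (combinations (separators N)) m → ∀ w → sat V w (sub σ φ₀))
    separated⇒refuted f g f-inj g-inj valid = contradictory id
      where
      col = Index (col-refining V) N f
      row = Index (row-refining V) N g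
      colIx : IsIndexing col
      colIx = record { total = Index-total (col-refining V) N f
                     ; onto = λ i → f i , Index-hit (col-refining V) N f f-inj i
                     ; unique = Index-unique (col-refining V) N f f-inj }
      rowIx : IsIndexing row
      rowIx = record { total = Index-total (row-refining V) N g
                     ; onto = λ i → g i , Index-hit (row-refining V) N g g-inj i
                     ; unique = Index-unique (row-refining V) N g g-inj }

      Pullback-resp : ∀ γ p {w v} → Agree V (separators N) w v →
        Pullback V₀ γ col row p w → Pullback V₀ γ col row p v
      Pullback-resp γ p {t} {t} ag e = e
      Pullback-resp γ p {t} {pt a b} ag e = ⊥-elim (τ-grid V nontrivial a b (proj₁ (ag τ (here refl)) (τ-top V)))
      Pullback-resp γ p {pt a b} {t} ag e = ⊥-elim (τ-grid V nontrivial a b (proj₂ (ag τ (here refl)) (τ-top V)))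
      Pullback-resp γ p {pt a b} {pt a′ b′} ag (i , j , ca , rb , e) = i , j ,
        Index-resp (col-refining V) N f i
          (Agree-trans V (colFms N) (colFms-invariant V N a 0 b)
            (Agree-trans V (colFms N) (λ δ → ag δ ∘ there ∘ ∈-++⁺ʳ (rowFms N)) (colFms-invariant V N a′ b′ 0))) ca ,
        Index-resp (row-refining V) N g j
          (Agree-trans V (rowFms N) (rowFms-invariant V N 0 a b)
            (Agree-trans V (rowFms N) (λ δ → ag δ ∘ there ∘ ∈-++⁺ˡ) (rowFms-invariant V N a′ 0 b′))) rb ,
        e

      contradictory : ¬¬ ⊥
      contradictory = do
        γ , isGrid ← latinSquare Δ₀ V₀
        σ , σ∈ , hσ ← substitutions-complete (combinations (separators N)) m
          (λ p χ → ∀ w → Iff (sat V w χ) (¬¬ (Pullback V₀ γ col row p w)))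
          (λ p → combinations-complete V (separators N) (Pullback V₀ γ col row p) (Pullback-resp γ p))
        λ _ → refute γ isGrid σ (valid σ σ∈) hσ w₀ refuted
        where
        refute : ∀ γ → IsGrid V₀ Δ₀ γ → ∀ σ → (∀ w → sat V w (sub σ φ₀)) →
          (∀ p → p < m → ∀ w → Iff (sat V w (σ p)) (¬¬ (Pullback V₀ γ col row p w))) →
          ∀ w → ¬ ¬ sat V₀ w φ₀
        refute γ isGrid σ all hσ t k =
          k (proj₁ (transfer-t V₀ γ col row isGrid colIx rowIx hσ φ₀ below) (all t))
        -- The refuting world agrees on `Δ₀` with some grid cell, and `pt (f i) (g j)` is a world
        -- indexed by that cell.
        refute γ isGrid σ all hσ (pt a b) k = IsGrid.covers isGrid a b λ { (i , j , ag) →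
          k (proj₂ (ag φ₀ (∈-subs φ₀)) (proj₁ (transfer V₀ γ col row isGrid colIx rowIx hσ φ₀ below (λ _ → id)
              (Index-hit (col-refining V) N f f-inj i) (Index-hit (row-refining V) N g g-inj j)) (all (pt (f i) (g j))))) }

-- Local tabularity

varBound : Fm → ℕ
varBound (var n) = suc n
varBound ⊥' = 0
varBound (φ ⇒ ψ) = varBound φ ⊔ varBound ψ
varBound (□₁ φ) = varBound φ
varBound (□₂ φ) = varBound φ

VarsBelow-mono : ∀ {m n} φ → m ≤ n → VarsBelow m φ → VarsBelow n φ
VarsBelow-mono (var i) m≤n i<m = <-≤-trans i<m m≤n
VarsBelow-mono ⊥' m≤n _ = tt
VarsBelow-mono (φ ⇒ ψ) m≤n (vφ , vψ) = VarsBelow-mono φ m≤n vφ , VarsBelow-mono ψ m≤n vψ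
VarsBelow-mono (□₁ φ) m≤n vφ = VarsBelow-mono φ m≤n vφ
VarsBelow-mono (□₂ φ) m≤n vφ = VarsBelow-mono φ m≤n vφ

VarsBelow-varBound : ∀ φ → VarsBelow (varBound φ) φ
VarsBelow-varBound (var n) = ≤-refl
VarsBelow-varBound ⊥' = tt
VarsBelow-varBound (φ ⇒ ψ) = VarsBelow-mono φ (m≤m⊔n _ _) (VarsBelow-varBound φ)
                           , VarsBelow-mono ψ (m≤n⊔m _ _) (VarsBelow-varBound ψ)
VarsBelow-varBound (□₁ φ) = VarsBelow-varBound φ
VarsBelow-varBound (□₂ φ) = VarsBelow-varBound φ

infixr 5 _⇒*_
_⇒*_ : List Fm → Fm → Fm
[] ⇒* χ = χ
(φ ∷ φs) ⇒* χ = φ ⇒ (φs ⇒* χ)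

⇒*-intro : ∀ V w φs χ → ((∀ φ → φ ∈ φs → sat V w φ) → sat V w χ) → sat V w (φs ⇒* χ)
⇒*-intro V w [] χ h = h λ _ ()
⇒*-intro V w (φ ∷ φs) χ h s = ⇒*-intro V w φs χ λ hs →
  h λ { _ (here refl) → s ; ψ (there ψ∈) → hs ψ ψ∈ }

-- Finite models from instances of the refuted formula

module _ (φ₀ : Fm) (k : ℕ) where

  levels : ℕ
  levels = length (codes (subs φ₀))

  -- The entries serve `onePoint`, `stable-rows` and `stable-cols` in this order. They are computed
  -- from `φ₀` and `k` alone, before any countermodel is at hand.
  allDims : List (ℕ × ℕ)
  allDims = (0 , 0) ∷ map (λ i → dims k i i) (upTo levels) ++ map (λ i → dims k (suc i) i) (upTo levels)

  models : List (FinModel k)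
  models = finModels k allDims

  allSubstitutions : List (ℕ → Fm)
  allSubstitutions = substitutions (combinations (separators k levels)) (varBound φ₀)

  -- From a grid point, R₁ followed by R₂ reaches every world, so the prefix makes an instance true
  -- throughout the model.
  instances : List Fm
  instances = map (λ σ → □₁ (□₂ (sub σ φ₀))) allSubstitutions

  HasModel : Val → World → Set
  HasModel V w = ∃₂ λ M x → M ∈ models × x ∈ points k M × Agrees k V w M x

  StabilizesAt : Val → ℕ → Set
  StabilizesAt V i = (∀ b b′ → RowEq k V i b b′ → ¬¬ (RowEq k V (suc i) b b′))
                   ⊎ (∀ a a′ → ColEq k V i a a′ → ¬¬ (ColEq k V (suc i) a a′))

  module _ (¬valid : ¬ Tack₂ φ₀) (V : Val) where

    instances⇒HasModel : ∀ w → (∀ φ → φ ∈ instances → sat V w φ) → ¬¬ (HasModel V w)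
    instances⇒HasModel t _ = collapsed-model k V allDims (here refl) t (inj₁ refl)
    instances⇒HasModel (pt a b) hyps = do
      inj₂ nontrivial ← em {Trivial k V}
        where inj₁ triv → collapsed-model k V allDims (here refl) (pt a b) (inj₂ triv)
      inj₁ (i , i< , st) ← em {∃ λ i → i < levels × StabilizesAt V i}
        where inj₂ ¬st → λ _ → unstable nontrivial λ i i< st → ¬st (i , i< , st)
      stable nontrivial i i< st
      where
      stable : ¬ Trivial k V → ∀ i → i < levels → StabilizesAt V i → ¬¬ (HasModel V (pt a b))
      stable nt i i< (inj₁ h) = stable-model k V (stable-rows k V nt i h) allDims
        (there (∈-++⁺ˡ (∈-map⁺ (λ i → dims k i i) (∈-upTo⁺ i<)))) a b
      stable nt i i< (inj₂ h) = stable-model k V (stable-cols k V nt i h) allDims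
        (there (∈-++⁺ʳ (map (λ i → dims k i i) (upTo levels)) (∈-map⁺ (λ i → dims k (suc i) i) (∈-upTo⁺ i<)))) a b

      everywhere : ∀ σ → σ ∈ allSubstitutions → ∀ w → sat V w (sub σ φ₀)
      everywhere σ σ∈ (pt a′ b′) = hyps _ (∈-map⁺ _ σ∈) (pt a′ b) refl (pt a′ b′) refl
      everywhere σ σ∈ t = hyps _ (∈-map⁺ _ σ∈) t tt t tt

      unstable : ¬ Trivial k V → ¬ (∀ i → i < levels → ¬ StabilizesAt V i)
      -- A countermodel to `φ₀` is available only under double negation, which is enough as the goal
      -- is absurdity.
      unstable nt strict = ¬valid λ V₀ w₀ → sat-stable V₀ w₀ φ₀ λ refuted →
        inequivalent-family (col-refining k V) levels (λ i i< h → strict i i< (inj₂ h)) λ { (f , f-inj) →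
        inequivalent-family (row-refining k V) levels (λ i i< h → strict i i< (inj₁ h)) λ { (g , g-inj) →
        separated⇒refuted k V nt φ₀ (VarsBelow-varBound φ₀) V₀ w₀ refuted f g f-inj g-inj everywhere } }

  -- Packs the semantic argument into one formula of `Tack₂`, from which the extension obtains
  -- `φ ⇒ ψ` by modus ponens with its own instances of `φ₀`.
  Equiv⇒Tack₂ : ¬ Tack₂ φ₀ → ∀ φ ψ → VarsBelow k φ → VarsBelow k ψ → Equiv k models φ ψ →
    Tack₂ (instances ⇒* (φ ⇒ ψ))
  Equiv⇒Tack₂ ¬valid φ ψ vφ vψ eq V w = ⇒*-intro V w instances (φ ⇒ ψ) λ hyps s →
    sat-stable V w ψ (do
      M , x , M∈ , x∈ , agrees ← instances⇒HasModel ¬valid V w hyps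
      return (proj₂ (agrees ψ vψ) (trans (sym (eq M x M∈ x∈)) (proj₁ (agrees φ vφ) s))))

-- Passing to the extension

module _ {L : Fm → Set} (normal : IsNormalLogic L) where
  open IsNormalLogic normal renaming (subst to substL)

  mp* : ∀ φs χ → (∀ φ → φ ∈ φs → L φ) → L (φs ⇒* χ) → L χ
  mp* [] χ h l = l
  mp* (φ ∷ φs) χ h l = mp* φs χ (λ ψ → h ψ ∘ there) (mp φ (φs ⇒* χ) (h φ (here refl)) l)

  instances∈L : ∀ φ₀ k → L φ₀ → ∀ φ → φ ∈ instances φ₀ k → L φ
  instances∈L φ₀ k l φ φ∈ with ∈-map⁻ (λ σ → □₁ (□₂ (sub σ φ₀))) φ∈
  ... | σ , _ , refl = nec₁ _ (nec₂ _ (substL σ φ₀ l))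

theorem6p18 : PrelocallyTabular Tack₂
theorem6p18 L (normal , extends , φ₀ , φ₀∈L , ¬valid) k = map proj₁ (proj₁ reps) , representative
  where
  reps = saturated k (models φ₀ k)

  implication : ∀ φ ψ → VarsBelow k φ → VarsBelow k ψ → Equiv k (models φ₀ k) φ ψ → L (φ ⇒ ψ)
  implication φ ψ vφ vψ eq = mp* normal (instances φ₀ k) (φ ⇒ ψ) (instances∈L normal φ₀ k φ₀∈L)
    (extends _ (Equiv⇒Tack₂ φ₀ k ¬valid φ ψ vφ vψ eq))

  representative : ∀ φ → VarsBelow k φ →
    ∃ λ ψ → ψ ∈ map proj₁ (proj₁ reps) × VarsBelow k ψ × (φ ≡[ L ] ψ)
  representative φ vφ =
    let (ψ , vψ) , ψ∈ , eq = represented k (models φ₀ k) (proj₁ reps) (proj₂ reps) φ vφ in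
    ψ , ∈-map⁺ proj₁ ψ∈ , vψ ,
    implication φ ψ vφ vψ eq , implication ψ φ vψ vφ (λ M x M∈ x∈ → sym (eq M x M∈ x∈))
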